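{- Let $\phi$ be a 3SAT instance on variables $s_1,\dots,s_n$ with clauses $C_1,\dots,C_m$, each clause being a disjunction of exactly three literals. Let $\mathcal{G}=\mathcal{G}(\phi)$ be the edge-weighted graph defined in the context. Then $\phi$ is satisfiable if and only if $\mathcal{G}$ has a realization in $\mathbb{R}$, i.e. a map $x:V(\mathcal{G})\to\mathbb{R}$ with $|x_u-x_v|=d_{uv}$ for every edge $\{u,v\}$.
   Context: The graph $\mathcal{G}(\phi)$ has vertex set consisting of: two vertices $\mathsf{A},\mathsf{B}$; for each variable $s_j$ ($j\le n$) two literal vertices, denoted $s_j$ and $\bar s_j$; and for each clause $i\le m$ eight new vertices $c_{i1},\dots,c_{i8}$. For clause $i$ and $h\in\{1,2,3\}$, let $\mathsf{L}_{ih}$ denote the literal vertex ($s_j$ or $\bar s_j$) of the $h$-th literal of clause $i$. Edges with weights: $\{\mathsf{A},\mathsf{B}\}$ weight 2; for each $j\le n$: $\{s_j,\bar s_j\}$ weight 2, $\{\mathsf{A},s_j\}$ weight 1, $\{\mathsf{A},\bar s_j\}$ weight 1. For each clause $i\le m$: $\{\mathsf{A},c_{i2}\}$ weight 4, $\{\mathsf{A},c_{i7}\}$ weight 2, $\{\mathsf{L}_{i1},c_{i2}\}$ weight 3, $\{\mathsf{L}_{i2},c_{i7}\}$ weight 1, $\{c_{i2},c_{i4}\}$ weight 2, $\{c_{i7},c_{i3}\}$ weight 4, $\{\mathsf{B},c_{i1}\}$ weight 4, $\{c_{i1},c_{i5}\}$ weight 2, $\{c_{i5},c_{i6}\}$ weight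 1, $\{c_{i3},c_{i6}\}$ weight 1, $\{c_{i4},c_{i6}\}$ weight 1, $\{\mathsf{L}_{i3},c_{i8}\}$ weight 4, $\{c_{i6},c_{i8}\}$ weight 2 (edges $\{\mathsf{A},\mathsf{L}_{ih}\}$ of weight 1 are already present). A truth assignment corresponds to positions via: $x_\mathsf{A}=0$, $x_\mathsf{B}=2$, and literal vertex at $1$ means TRUE, at $-1$ means FALSE. -}

module Defs where

open import Data.Bool.Base using (Bool; true; not)
open import Data.Fin.Base using (Fin; zero; suc)
open import Data.Integer.Base using (+_)
open import Data.Integer.Solver using () renaming (module +-*-Solver to ℤ-Solver)
open import Data.Nat.Base as ℕ using (ℕ; suc)
open import Data.Product.Base using (∃-syntax)
open import Data.Rational.Base as ℚ using (ℚ; 0ℚ; _/_)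
import Data.Rational.Properties as ℚₚ
open import Data.Rational.Solver using () renaming (module +-*-Solver to ℚ-Solver)
import Data.Rational.Unnormalised.Base as ℚᵘ
import Data.Rational.Unnormalised.Properties as ℚᵘₚ
open import Data.Sum.Base using (inj₁; inj₂)
open import Data.Vec.Base using (Vec; lookup)
open import Data.Vec.Relation.Unary.All using (All)
open import Data.Vec.Relation.Unary.Any using (Any)
open import Relation.Binary.PropositionalEquality

-- Bishop reals: a real is a regular sequence of
-- rationals, |xₘ - xₙ| ≤ 1/(m+1) + 1/(n+1), and reals x, y are equal when
-- |xₙ - yₙ| ≤ 2/(n+1) for all n.

ε : ℕ → ℚ
ε n = + 1 / suc n

record ℝ : Set where
  constructor mkℝ
  field
    seq     : ℕ → ℚ
    regular : ∀ m n → ℚ.∣ seq m ℚ.- seq n ∣ ℚ.≤ ε m ℚ.+ ε n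

open ℝ public

infix 4 _≈_
record _≈_ (x y : ℝ) : Set where
  constructor mk≈
  field
    close : ∀ n → ℚ.∣ seq x n ℚ.- seq y n ∣ ℚ.≤ ε n ℚ.+ ε n

open _≈_ public

0≤ε : ∀ n → 0ℚ ℚ.≤ ε n
0≤ε n = ℚₚ.nonNegative⁻¹ (ε n) {{ℚₚ.normalize-nonNeg 1 (suc n)}}

ε-double : ∀ n → ε (suc (n ℕ.+ n)) ℚ.+ ε (suc (n ℕ.+ n)) ≡ ε n
ε-double n = ℚₚ.toℚᵘ-injective (begin
  ℚ.toℚᵘ (ε k ℚ.+ ε k)             ≈⟨ ℚₚ.toℚᵘ-homo-+ (ε k) (ε k) ⟩
  ℚ.toℚᵘ (ε k) ℚᵘ.+ ℚ.toℚᵘ (ε k)   ≈⟨ ℚᵘₚ.+-cong (εᵘ k) (εᵘ k) ⟩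
  ℚᵘ.mkℚᵘ (+ 1) k ℚᵘ.+ ℚᵘ.mkℚᵘ (+ 1) k
    ≈⟨ ℚᵘ.*≡* (solve 1 (λ a →
         let 2a = con (+ 1) :+ (con (+ 1) :+ (a :+ a)) in
         (con (+ 1) :* 2a :+ con (+ 1) :* 2a) :* (con (+ 1) :+ a)
         := con (+ 1) :* (2a :* 2a)) refl (+ n)) ⟩
  ℚᵘ.mkℚᵘ (+ 1) n                  ≈⟨ ℚᵘₚ.≃-sym (εᵘ n) ⟩
  ℚ.toℚᵘ (ε n)                     ∎)
  where
  open ℚᵘₚ.≃-Reasoning
  open ℤ-Solver
  k = suc (n ℕ.+ n)
  εᵘ : ∀ j → ℚ.toℚᵘ (ε j) ℚᵘ.≃ ℚᵘ.mkℚᵘ (+ 1) j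
  εᵘ j = ℚₚ.toℚᵘ-fromℚᵘ (ℚᵘ.mkℚᵘ (+ 1) j)

∣p∣≤q : ∀ {p q} → p ℚ.≤ q → ℚ.- p ℚ.≤ q → ℚ.∣ p ∣ ℚ.≤ q
∣p∣≤q {p} p≤q -p≤q with ℚₚ.∣p∣≡p∨∣p∣≡-p p
... | inj₁ eq rewrite eq = p≤q
... | inj₂ eq rewrite eq = -p≤q

∣p∣-∣q∣≤∣p-q∣ : ∀ p q → ℚ.∣ p ∣ ℚ.- ℚ.∣ q ∣ ℚ.≤ ℚ.∣ p ℚ.- q ∣
∣p∣-∣q∣≤∣p-q∣ p q = begin
  ℚ.∣ p ∣ ℚ.- ℚ.∣ q ∣
    ≡⟨ cong (λ z → ℚ.∣ z ∣ ℚ.- ℚ.∣ q ∣)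
         (solve 2 (λ a b → a := (a :- b) :+ b) refl p q) ⟩
  ℚ.∣ (p ℚ.- q) ℚ.+ q ∣ ℚ.- ℚ.∣ q ∣
    ≤⟨ ℚₚ.+-monoˡ-≤ (ℚ.- ℚ.∣ q ∣) (ℚₚ.∣p+q∣≤∣p∣+∣q∣ (p ℚ.- q) q) ⟩
  (ℚ.∣ p ℚ.- q ∣ ℚ.+ ℚ.∣ q ∣) ℚ.- ℚ.∣ q ∣
    ≡⟨ solve 2 (λ a b → (a :+ b) :- b := a) refl ℚ.∣ p ℚ.- q ∣ ℚ.∣ q ∣ ⟩
  ℚ.∣ p ℚ.- q ∣ ∎
  where
  open ℚₚ.≤-Reasoning
  open ℚ-Solver

∣p-q∣≡∣q-p∣ : ∀ p q → ℚ.∣ p ℚ.- q ∣ ≡ ℚ.∣ q ℚ.- p ∣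
∣p-q∣≡∣q-p∣ p q = trans (sym (ℚₚ.∣-p∣≡∣p∣ (p ℚ.- q)))
  (cong ℚ.∣_∣ (solve 2 (λ a b → :- (a :- b) := b :- a) refl p q))
  where open ℚ-Solver

fromℕ : ℕ → ℝ
fromℕ k .seq     _   = + k / 1
fromℕ k .regular m n = begin
  ℚ.∣ + k / 1 ℚ.- + k / 1 ∣ ≡⟨ cong ℚ.∣_∣ (ℚₚ.+-inverseʳ (+ k / 1)) ⟩
  0ℚ ℚ.+ 0ℚ                 ≤⟨ ℚₚ.+-mono-≤ (0≤ε m) (0≤ε n) ⟩
  ε m ℚ.+ ε n               ∎
  where open ℚₚ.≤-Reasoning

infixl 6 _-_
_-_ : ℝ → ℝ → ℝ
(x - y) .seq     n   = seq x (suc (n ℕ.+ n)) ℚ.- seq y (suc (n ℕ.+ n))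
(x - y) .regular m n = begin
  ℚ.∣ (seq x m′ ℚ.- seq y m′) ℚ.- (seq x n′ ℚ.- seq y n′) ∣
    ≡⟨ cong ℚ.∣_∣ (solve 4 (λ a b c d →
         (a :- b) :- (c :- d) := (a :- c) :- (b :- d)) refl
         (seq x m′) (seq y m′) (seq x n′) (seq y n′)) ⟩
  ℚ.∣ (seq x m′ ℚ.- seq x n′) ℚ.- (seq y m′ ℚ.- seq y n′) ∣
    ≤⟨ ℚₚ.∣p-q∣≤∣p∣+∣q∣ (seq x m′ ℚ.- seq x n′) (seq y m′ ℚ.- seq y n′) ⟩
  ℚ.∣ seq x m′ ℚ.- seq x n′ ∣ ℚ.+ ℚ.∣ seq y m′ ℚ.- seq y n′ ∣
    ≤⟨ ℚₚ.+-mono-≤ (regular x m′ n′) (regular y m′ n′) ⟩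
  (ε m′ ℚ.+ ε n′) ℚ.+ (ε m′ ℚ.+ ε n′)
    ≡⟨ solve 2 (λ a b → (a :+ b) :+ (a :+ b) := (a :+ a) :+ (b :+ b)) refl
         (ε m′) (ε n′) ⟩
  (ε m′ ℚ.+ ε m′) ℚ.+ (ε n′ ℚ.+ ε n′)
    ≡⟨ cong₂ ℚ._+_ (ε-double m) (ε-double n) ⟩
  ε m ℚ.+ ε n ∎
  where
  open ℚₚ.≤-Reasoning
  open ℚ-Solver
  m′ = suc (m ℕ.+ m)
  n′ = suc (n ℕ.+ n)

∣_∣ : ℝ → ℝ
∣ x ∣ .seq     n   = ℚ.∣ seq x n ∣
∣ x ∣ .regular m n = ℚₚ.≤-trans (∣p∣≤q
    (∣p∣-∣q∣≤∣p-q∣ p q)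
    (subst₂ ℚ._≤_
      (solve 2 (λ a b → b :- a := :- (a :- b)) refl ℚ.∣ p ∣ ℚ.∣ q ∣)
      (∣p-q∣≡∣q-p∣ q p)
      (∣p∣-∣q∣≤∣p-q∣ q p)))
  (regular x m n)
  where
  open ℚ-Solver
  p = seq x m
  q = seq x n

data Literal (n : ℕ) : Set where
  pos neg : Fin n → Literal n

Clause : ℕ → Set
Clause n = Vec (Literal n) 3

3SAT : ℕ → ℕ → Set
3SAT n m = Vec (Clause n) m

Assignment : ℕ → Set
Assignment n = Fin n → Bool

eval : ∀ {n} → Assignment n → Literal n → Bool
eval a (pos j) = a j
eval a (neg j) = not (a j)

Satisfies : ∀ {n m} → Assignment n → 3SAT n m → Set
Satisfies a φ = All (Any (λ ℓ → eval a ℓ ≡ true)) φ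

Satisfiable : ∀ {n m} → 3SAT n m → Set
Satisfiable φ = ∃[ a ] Satisfies a φ

-- An element of Edge u v d is an undirected edge {u,v} of weight d; each edge
-- need only be given in one of its two orientations.
record WeightedGraph : Set₁ where
  field
    Vertex : Set
    Edge   : Vertex → Vertex → ℕ → Set

IsRealization : (G : WeightedGraph) → (WeightedGraph.Vertex G → ℝ) → Set
IsRealization G x = ∀ {u v d} → Edge u v d → ∣ x u - x v ∣ ≈ fromℕ d
  where open WeightedGraph G

HasRealization : WeightedGraph → Set
HasRealization G = ∃[ x ] IsRealization G x

data Vertex (n m : ℕ) : Set where
  A B                     : Vertex n m
  lit                     : Literal n → Vertex n m
  c₁ c₂ c₃ c₄ c₅ c₆ c₇ c₈ : Fin m → Vertex n m

module _ {n m : ℕ} (φ : 3SAT n m) where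

  L₁ L₂ L₃ : Fin m → Vertex n m
  L₁ i = lit (lookup (lookup φ i) zero)
  L₂ i = lit (lookup (lookup φ i) (suc zero))
  L₃ i = lit (lookup (lookup φ i) (suc (suc zero)))

  data Edge : Vertex n m → Vertex n m → ℕ → Set where
    A—B   : Edge A B 2
    s—s̄   : ∀ j → Edge (lit (pos j)) (lit (neg j)) 2
    A—s   : ∀ j → Edge A (lit (pos j)) 1
    A—s̄   : ∀ j → Edge A (lit (neg j)) 1
    A—c₂  : ∀ i → Edge A (c₂ i) 4
    A—c₇  : ∀ i → Edge A (c₇ i) 2
    L₁—c₂ : ∀ i → Edge (L₁ i) (c₂ i) 3
    L₂—c₇ : ∀ i → Edge (L₂ i) (c₇ i) 1
    c₂—c₄ : ∀ i → Edge (c₂ i) (c₄ i) 2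
    c₇—c₃ : ∀ i → Edge (c₇ i) (c₃ i) 4
    B—c₁  : ∀ i → Edge B (c₁ i) 4
    c₁—c₅ : ∀ i → Edge (c₁ i) (c₅ i) 2
    c₅—c₆ : ∀ i → Edge (c₅ i) (c₆ i) 1
    c₃—c₆ : ∀ i → Edge (c₃ i) (c₆ i) 1
    c₄—c₆ : ∀ i → Edge (c₄ i) (c₆ i) 1
    L₃—c₈ : ∀ i → Edge (L₃ i) (c₈ i) 4
    c₆—c₈ : ∀ i → Edge (c₆ i) (c₈ i) 2

  𝒢 : WeightedGraph
  𝒢 = record { Vertex = Vertex n m ; Edge = Edge }

{-# OPTIONS --safe #-}

-- Passing to integers: truncating a real realization far enough gives rational
-- positions in which every edge has its length up to 1/8.  All vertices lie within
-- three edges of A, so each position relative to A is within 3/8 of an integer,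
-- and since 3/8 + 3/8 + 1/8 < 1 those integers realize all lengths exactly.
--
-- With A at 0, B at 2 and the literals at τ₁, τ₂, τ₃ ∈ {1, -1}, the paths from A
-- and from the literals force c₆ = 4τ₁ + 2τ₂ + τ₃, an arbitrary odd number from
-- -7 to 7.  The path from B through c₁ and c₅ puts c₆ at an odd number from -5
-- to 9, which excludes exactly the all-false value -7.

module Submission where

open import Defs
open import Data.Bool.Base using (Bool; true; false; not)
open import Data.Empty using (⊥; ⊥-elim)
open import Data.Fin.Base using (Fin; zero; suc)
open import Data.Integer.Base as ℤ using (ℤ; +_; -[1+_]; +[1+_]; 0ℤ; 1ℤ; -1ℤ)
import Data.Integer.Properties as ℤₚ
open import Data.Integer.Solver using () renaming (module +-*-Solver to ℤ-Solver)
open import Data.Nat.Base as ℕ using (ℕ; zero; suc)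
import Data.Nat.Coprimality as Coprimality
import Data.Nat.Properties as ℕₚ
open import Data.Product.Base using (∃-syntax; _×_; _,_; proj₁; proj₂)
open import Data.Rational.Base as ℚ using (ℚ; 0ℚ; 1ℚ; mkℚ; _/_)
import Data.Rational.Properties as ℚₚ
open import Data.Rational.Solver using () renaming (module +-*-Solver to ℚ-Solver)
open import Data.Sum.Base using (_⊎_; inj₁; inj₂)
open import Data.Vec.Base using ([]; _∷_; lookup)
open import Data.Vec.Relation.Unary.All.Properties using (lookup⁺; lookup⁻)
open import Data.Vec.Relation.Unary.Any using (Any; here; there)
open import Function.Base using (_∘_)
open import Function.Bundles using (_⇔_; mk⇔)
open import Relation.Binary.PropositionalEquality
open import Relation.Nullary.Negation.Core using (contradiction)
open import Relation.Nullary.Decidable using (does; toWitness)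

-- The embedding of the integers in the rationals.

-- Given in reduced form with denominator 1: unlike for `k / 1`, negation and absolute value then
-- compute by cases on `k`.
fromℤ : ℤ → ℚ
fromℤ k = mkℚ k 0 (Coprimality.sym (Coprimality.1-coprimeTo _))

fromℤ≡/1 : ∀ k → k / 1 ≡ fromℤ k
fromℤ≡/1 k = ℚₚ.↥p/↧p≡p (fromℤ k)

-- Addition of fractions over 1 unfolds to `(i * 1 + j * 1) / 1`, so only the factors 1 have to be
-- removed.
fromℤ-+ : ∀ i j → fromℤ (i ℤ.+ j) ≡ fromℤ i ℚ.+ fromℤ j
fromℤ-+ i j = trans (sym (fromℤ≡/1 (i ℤ.+ j)))
  (cong (_/ 1) (sym (cong₂ ℤ._+_ (ℤₚ.*-identityʳ i) (ℤₚ.*-identityʳ j))))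

fromℤ-neg : ∀ i → fromℤ (ℤ.- i) ≡ ℚ.- fromℤ i
fromℤ-neg (+ zero)  = refl
fromℤ-neg +[1+ _ ]  = refl
fromℤ-neg -[1+ _ ]  = refl

fromℤ-- : ∀ i j → fromℤ (i ℤ.- j) ≡ fromℤ i ℚ.- fromℤ j
fromℤ-- i j = trans (fromℤ-+ i (ℤ.- j)) (cong (fromℤ i ℚ.+_) (fromℤ-neg j))

fromℤ-∣-∣ : ∀ i → fromℤ (+ ℤ.∣ i ∣) ≡ ℚ.∣ fromℤ i ∣
fromℤ-∣-∣ (+ _)    = refl
fromℤ-∣-∣ -[1+ _ ] = refl

-- Discreteness of the integers, which turns approximate lengths into exact ones. The inequality
-- unfolds to one between natural numbers that no nonzero numerator satisfies.
∣fromℤ∣<1⇒≡0 : ∀ {i} → ℚ.∣ fromℤ i ∣ ℚ.< 1ℚ → i ≡ 0ℤ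
∣fromℤ∣<1⇒≡0 {+ zero}   _ = refl
∣fromℤ∣<1⇒≡0 {+[1+ n ]} (ℚ.*<* (ℤ.+<+ (ℕ.s≤s p))) rewrite ℕₚ.*-identityʳ n with () ← p
∣fromℤ∣<1⇒≡0 { -[1+ n ]} (ℚ.*<* (ℤ.+<+ (ℕ.s≤s p))) rewrite ℕₚ.*-identityʳ n with () ← p

∣∣p∣-∣q∣∣≤∣p-q∣ : ∀ p q → ℚ.∣ ℚ.∣ p ∣ ℚ.- ℚ.∣ q ∣ ∣ ℚ.≤ ℚ.∣ p ℚ.- q ∣
∣∣p∣-∣q∣∣≤∣p-q∣ p q = ∣p∣≤q (∣p∣-∣q∣≤∣p-q∣ p q)
  (subst₂ ℚ._≤_
    (solve 2 (λ a b → b :- a := :- (a :- b)) refl ℚ.∣ p ∣ ℚ.∣ q ∣)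
    (∣p-q∣≡∣q-p∣ q p)
    (∣p∣-∣q∣≤∣p-q∣ q p))
  where open ℚ-Solver

-- Rational positions close to integers

Near : ℚ → ℚ → Set
Near t q = ∃[ k ] ℚ.∣ q ℚ.- fromℤ k ∣ ℚ.≤ t

-- The sign of `p - q` is decidable for rationals and selects `k - d` or `k + d` as the integer near
-- `q`. The errors of the position `p` and of the length add up.
near-step : ∀ {t δ} p q d → Near t p →
  ℚ.∣ ℚ.∣ p ℚ.- q ∣ ℚ.- fromℤ d ∣ ℚ.≤ δ → Near (t ℚ.+ δ) q
near-step {t} {δ} p q d (k , p~k) p—q with ℚₚ.∣p∣≡p∨∣p∣≡-p (p ℚ.- q)
... | inj₁ eq rewrite eq = k ℤ.- d , (begin
  ℚ.∣ q ℚ.- fromℤ (k ℤ.- d) ∣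
    ≡⟨ cong (λ z → ℚ.∣ q ℚ.- z ∣) (fromℤ-- k d) ⟩
  ℚ.∣ q ℚ.- (fromℤ k ℚ.- fromℤ d) ∣
    ≡⟨ cong ℚ.∣_∣ (solve 4 (λ p q k d →
         q :- (k :- d) := (p :- k) :- ((p :- q) :- d)) refl p q (fromℤ k) (fromℤ d)) ⟩
  ℚ.∣ (p ℚ.- fromℤ k) ℚ.- ((p ℚ.- q) ℚ.- fromℤ d) ∣
    ≤⟨ ℚₚ.∣p-q∣≤∣p∣+∣q∣ (p ℚ.- fromℤ k) ((p ℚ.- q) ℚ.- fromℤ d) ⟩
  ℚ.∣ p ℚ.- fromℤ k ∣ ℚ.+ ℚ.∣ (p ℚ.- q) ℚ.- fromℤ d ∣
    ≤⟨ ℚₚ.+-mono-≤ p~k p—q ⟩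
  t ℚ.+ δ ∎)
  where
  open ℚₚ.≤-Reasoning
  open ℚ-Solver
... | inj₂ eq rewrite eq = k ℤ.+ d , (begin
  ℚ.∣ q ℚ.- fromℤ (k ℤ.+ d) ∣
    ≡⟨ cong (λ z → ℚ.∣ q ℚ.- z ∣) (fromℤ-+ k d) ⟩
  ℚ.∣ q ℚ.- (fromℤ k ℚ.+ fromℤ d) ∣
    ≡⟨ cong ℚ.∣_∣ (solve 4 (λ p q k d →
         q :- (k :+ d) := (p :- k) :+ (:- (p :- q) :- d)) refl p q (fromℤ k) (fromℤ d)) ⟩
  ℚ.∣ (p ℚ.- fromℤ k) ℚ.+ (ℚ.- (p ℚ.- q) ℚ.- fromℤ d) ∣
    ≤⟨ ℚₚ.∣p+q∣≤∣p∣+∣q∣ (p ℚ.- fromℤ k) (ℚ.- (p ℚ.- q) ℚ.- fromℤ d) ⟩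
  ℚ.∣ p ℚ.- fromℤ k ∣ ℚ.+ ℚ.∣ ℚ.- (p ℚ.- q) ℚ.- fromℤ d ∣
    ≤⟨ ℚₚ.+-mono-≤ p~k p—q ⟩
  t ℚ.+ δ ∎)
  where
  open ℚₚ.≤-Reasoning
  open ℚ-Solver

-- The integer `|k - l| - d` differs from `|p - q| - d` by at most the two position errors, so its
-- size is below 1 and it vanishes.
near-distance : ∀ {t δ} p q {d} → (t ℚ.+ t) ℚ.+ δ ℚ.< 1ℚ →
  ((k , _) : Near t p) ((l , _) : Near t q) →
  ℚ.∣ ℚ.∣ p ℚ.- q ∣ ℚ.- fromℤ (+ d) ∣ ℚ.≤ δ → ℤ.∣ k ℤ.- l ∣ ≡ d
near-distance {t} {δ} p q {d} small (k , p~k) (l , q~l) p—q =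
  ℤₚ.+-injective (ℤₚ.i-j≡0⇒i≡j _ _ (∣fromℤ∣<1⇒≡0 (begin-strict
    ℚ.∣ fromℤ (+ ℤ.∣ k ℤ.- l ∣ ℤ.- + d) ∣
      ≡⟨ cong ℚ.∣_∣ (fromℤ-- (+ ℤ.∣ k ℤ.- l ∣) (+ d)) ⟩
    ℚ.∣ fromℤ (+ ℤ.∣ k ℤ.- l ∣) ℚ.- D ∣
      ≡⟨ cong (λ z → ℚ.∣ z ℚ.- D ∣)
           (trans (fromℤ-∣-∣ (k ℤ.- l)) (cong ℚ.∣_∣ (fromℤ-- k l))) ⟩
    ℚ.∣ ℚ.∣ K ℚ.- L ∣ ℚ.- D ∣
      ≡⟨ cong ℚ.∣_∣ (solve 3 (λ a b c → a :- c := (a :- b) :+ (b :- c)) refl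
           ℚ.∣ K ℚ.- L ∣ ℚ.∣ p ℚ.- q ∣ D) ⟩
    ℚ.∣ (ℚ.∣ K ℚ.- L ∣ ℚ.- ℚ.∣ p ℚ.- q ∣) ℚ.+ (ℚ.∣ p ℚ.- q ∣ ℚ.- D) ∣
      ≤⟨ ℚₚ.∣p+q∣≤∣p∣+∣q∣ (ℚ.∣ K ℚ.- L ∣ ℚ.- ℚ.∣ p ℚ.- q ∣) (ℚ.∣ p ℚ.- q ∣ ℚ.- D) ⟩
    ℚ.∣ ℚ.∣ K ℚ.- L ∣ ℚ.- ℚ.∣ p ℚ.- q ∣ ∣ ℚ.+ ℚ.∣ ℚ.∣ p ℚ.- q ∣ ℚ.- D ∣
      ≤⟨ ℚₚ.+-mono-≤ (∣∣p∣-∣q∣∣≤∣p-q∣ (K ℚ.- L) (p ℚ.- q)) p—q ⟩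
    ℚ.∣ (K ℚ.- L) ℚ.- (p ℚ.- q) ∣ ℚ.+ δ
      ≡⟨ cong (λ z → ℚ.∣ z ∣ ℚ.+ δ) (solve 4 (λ k l p q →
           (k :- l) :- (p :- q) := (q :- l) :- (p :- k)) refl K L p q) ⟩
    ℚ.∣ (q ℚ.- L) ℚ.- (p ℚ.- K) ∣ ℚ.+ δ
      ≤⟨ ℚₚ.+-monoˡ-≤ δ (ℚₚ.∣p-q∣≤∣p∣+∣q∣ (q ℚ.- L) (p ℚ.- K)) ⟩
    (ℚ.∣ q ℚ.- L ∣ ℚ.+ ℚ.∣ p ℚ.- K ∣) ℚ.+ δ
      ≤⟨ ℚₚ.+-monoˡ-≤ δ (ℚₚ.+-mono-≤ q~l p~k) ⟩
    (t ℚ.+ t) ℚ.+ δ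
      <⟨ small ⟩
    1ℚ ∎)))
  where
  open ℚₚ.≤-Reasoning
  open ℚ-Solver
  K = fromℤ k
  L = fromℤ l
  D = fromℤ (+ d)

-- Integer realizations

IsIntegerRealization : (G : WeightedGraph) → (WeightedGraph.Vertex G → ℤ) → Set
IsIntegerRealization G x = ∀ {u v d} → E u v d → ℤ.∣ x u ℤ.- x v ∣ ≡ d
  where open WeightedGraph G renaming (Edge to E)

HasIntegerRealization : WeightedGraph → Set
HasIntegerRealization G = ∃[ x ] IsIntegerRealization G x

module _ (G : WeightedGraph) where

  open WeightedGraph G renaming (Vertex to V; Edge to E)

  -- The index bounds the number of edges instead of counting them, since `start` fits every `k`.
  -- Paths follow edges in their listed orientation.
  data WithinEdges (r : V) : ℕ → V → Set where
    start : ∀ {k} → WithinEdges r k r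
    _▹_   : ∀ {k u v d} → WithinEdges r k u → E u v d → WithinEdges r (suc k) v

  integer⇒real : HasIntegerRealization G → HasRealization G
  integer⇒real (x , x-realizes) = const ∘ x , λ {u} {v} {d} e → mk≈ λ n → begin
    ℚ.∣ ℚ.∣ fromℤ (x u) ℚ.- fromℤ (x v) ∣ ℚ.- + d / 1 ∣
      ≡⟨ cong ℚ.∣_∣ (trans (cong₂ ℚ._-_ (length e) (fromℤ≡/1 (+ d)))
           (ℚₚ.+-inverseʳ (fromℤ (+ d)))) ⟩
    0ℚ ℚ.+ 0ℚ
      ≤⟨ ℚₚ.+-mono-≤ (0≤ε n) (0≤ε n) ⟩
    ε n ℚ.+ ε n ∎
    where
    open ℚₚ.≤-Reasoning
    const : ℤ → ℝ
    const k .seq     _   = fromℤ k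
    const k .regular m n = begin
      ℚ.∣ fromℤ k ℚ.- fromℤ k ∣ ≡⟨ cong ℚ.∣_∣ (ℚₚ.+-inverseʳ (fromℤ k)) ⟩
      0ℚ ℚ.+ 0ℚ                 ≤⟨ ℚₚ.+-mono-≤ (0≤ε m) (0≤ε n) ⟩
      ε m ℚ.+ ε n               ∎
    length : ∀ {u v d} → E u v d → ℚ.∣ fromℤ (x u) ℚ.- fromℤ (x v) ∣ ≡ fromℤ (+ d)
    length {u} {v} e = trans (cong ℚ.∣_∣ (sym (fromℤ-- (x u) (x v))))
      (trans (sym (fromℤ-∣-∣ (x u ℤ.- x v))) (cong (fromℤ ∘ +_) (x-realizes e)))

  real⇒integer : ∀ r → (∀ v → WithinEdges r 3 v) → HasRealization G → HasIntegerRealization G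
  real⇒integer r within (x , x-realizes) = proj₁ ∘ rounded , λ {u} {v} e →
    near-distance (y u) (y v) (toWitness {a? = (tol 3 ℚ.+ tol 3) ℚ.+ δ ℚₚ.<? 1ℚ} _)
      (rounded u) (rounded v) (approx e)
    where
    -- The closeness bound at index 15, equal to 1/8. Two endpoints with error `3δ` and one edge
    -- with error `δ` give 7/8, and `toWitness` checks by evaluation that this is below 1.
    δ : ℚ
    δ = ε 15 ℚ.+ ε 15

    tol : ℕ → ℚ
    tol zero    = 0ℚ
    tol (suc k) = tol k ℚ.+ δ

    0≤tol : ∀ k → 0ℚ ℚ.≤ tol k
    0≤tol zero    = ℚₚ.≤-refl
    0≤tol (suc k) = ℚₚ.+-mono-≤ (0≤tol k) (ℚₚ.+-mono-≤ (0≤ε 15) (0≤ε 15))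

    -- 31 is the index at which x u - x v evaluates x u and x v for its 15th term.
    y : V → ℚ
    y v = seq (x v) 31 ℚ.- seq (x r) 31

    approx : ∀ {u v d} → E u v d → ℚ.∣ ℚ.∣ y u ℚ.- y v ∣ ℚ.- fromℤ (+ d) ∣ ℚ.≤ δ
    approx {u} {v} {d} e = subst₂ (λ a b → ℚ.∣ ℚ.∣ a ∣ ℚ.- b ∣ ℚ.≤ δ)
      (solve 3 (λ a b c → a :- b := (a :- c) :- (b :- c)) refl
        (seq (x u) 31) (seq (x v) 31) (seq (x r) 31))
      (fromℤ≡/1 (+ d))
      (close (x-realizes e) 15)
      where open ℚ-Solver

    near : ∀ {k v} → WithinEdges r k v → Near (tol k) (y v)
    -- `y` subtracts the position of the root, which therefore sits at exactly 0 and meets every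
    -- bound `tol k`.
    near {k} start =
      0ℤ , subst (λ z → ℚ.∣ z ℚ.- 0ℚ ∣ ℚ.≤ tol k) (sym (ℚₚ.+-inverseʳ (seq (x r) 31))) (0≤tol k)
    near (_▹_ {u = u} {v} {d} w e) = near-step (y u) (y v) (+ d) (near w) (approx e)

    rounded : ∀ v → Near (tol 3) (y v)
    rounded v = near (within v)

∣i∣≡n⇒i≡±n : ∀ {i n} → ℤ.∣ i ∣ ≡ n → i ≡ + n ⊎ i ≡ ℤ.- (+ n)
∣i∣≡n⇒i≡±n {+ _}      refl = inj₁ refl
∣i∣≡n⇒i≡±n { -[1+ _ ]} refl = inj₂ refl

-- Turns an edge equation into two explicit candidates, so that positions can be found by branching
-- outward from known vertices.
neighbour : ∀ i j {d} → ℤ.∣ i ℤ.- j ∣ ≡ d → j ≡ i ℤ.- + d ⊎ j ≡ i ℤ.+ + d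
neighbour i j {d} eq with ∣i∣≡n⇒i≡±n {i ℤ.- j} eq
... | inj₁ i-j = inj₁ (trans (solve 2 (λ a b → b := a :- (a :- b)) refl i j)
                             (cong (λ z → i ℤ.- z) i-j))
  where open ℤ-Solver
... | inj₂ i-j = inj₂ (trans (trans (solve 2 (λ a b → b := a :- (a :- b)) refl i j)
                                    (cong (λ z → i ℤ.- z) i-j))
                             (cong (λ z → i ℤ.+ z) (ℤₚ.neg-involutive (+ d))))
  where open ℤ-Solver

-- Paths from `A` and normal position of a realization.

module _ {n m : ℕ} (φ : 3SAT n m) where

  -- Radius 3 is attained at `c₅` and `c₆`.
  A-centre : ∀ v → WithinEdges (𝒢 φ) A 3 v
  A-centre = λ where
      A      → start
      B      → start ▹ A—B
      (lit ℓ) → literal ℓ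
      (c₁ i) → (start ▹ A—B) ▹ B—c₁ i
      (c₂ i) → start ▹ A—c₂ i
      (c₃ i) → (start ▹ A—c₇ i) ▹ c₇—c₃ i
      (c₄ i) → (start ▹ A—c₂ i) ▹ c₂—c₄ i
      (c₅ i) → ((start ▹ A—B) ▹ B—c₁ i) ▹ c₁—c₅ i
      (c₆ i) → ((start ▹ A—c₂ i) ▹ c₂—c₄ i) ▹ c₄—c₆ i
      (c₇ i) → start ▹ A—c₇ i
      (c₈ i) → literal _ ▹ L₃—c₈ i
    where
    literal : ∀ {k} ℓ → WithinEdges (𝒢 φ) A (suc k) (lit ℓ)
    literal (pos j) = start ▹ A—s j
    literal (neg j) = start ▹ A—s̄ j

  -- Translations and the reflection of ℤ preserve realizations.
  normalize : HasIntegerRealization (𝒢 φ) →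
    ∃[ x ] IsIntegerRealization (𝒢 φ) x × x A ≡ + 0 × x B ≡ + 2
  normalize (x , x-realizes) = case (neighbour (x A) (x B) (x-realizes A—B))
    where
    open ℤ-Solver
    moved : ℤ → Vertex n m → ℤ
    moved s v = s ℤ.* (x v ℤ.- x A)

    moved-realizes : ∀ s → ℤ.∣ s ∣ ≡ 1 → IsIntegerRealization (𝒢 φ) (moved s)
    moved-realizes s ∣s∣≡1 {u} {v} {d} e = begin
      ℤ.∣ moved s u ℤ.- moved s v ∣
        ≡⟨ cong ℤ.∣_∣ (solve 4 (λ s u v a → s :* (u :- a) :- s :* (v :- a) := s :* (u :- v))
             refl s (x u) (x v) (x A)) ⟩
      ℤ.∣ s ℤ.* (x u ℤ.- x v) ∣       ≡⟨ ℤₚ.abs-* s (x u ℤ.- x v) ⟩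
      ℤ.∣ s ∣ ℕ.* ℤ.∣ x u ℤ.- x v ∣   ≡⟨ cong₂ ℕ._*_ ∣s∣≡1 (x-realizes e) ⟩
      1 ℕ.* d                         ≡⟨ ℕₚ.*-identityˡ d ⟩
      d ∎
      where open ≡-Reasoning

    A↦0 : ∀ s → moved s A ≡ + 0
    A↦0 s = solve 2 (λ s a → s :* (a :- a) := con 0ℤ) refl s (x A)

    case : x B ≡ x A ℤ.- + 2 ⊎ x B ≡ x A ℤ.+ + 2 →
      ∃[ y ] IsIntegerRealization (𝒢 φ) y × y A ≡ + 0 × y B ≡ + 2
    case (inj₁ left)  = moved -1ℤ , moved-realizes -1ℤ refl , A↦0 -1ℤ ,
      trans (cong (λ b → -1ℤ ℤ.* (b ℤ.- x A)) left)
        (solve 1 (λ a → con -1ℤ :* ((a :- con (+ 2)) :- a) := con (+ 2)) refl (x A))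
    case (inj₂ right) = moved 1ℤ , moved-realizes 1ℤ refl , A↦0 1ℤ ,
      trans (cong (λ b → 1ℤ ℤ.* (b ℤ.- x A)) right)
        (solve 1 (λ a → con 1ℤ :* ((a :+ con (+ 2)) :- a) := con (+ 2)) refl (x A))

±1 : Bool → ℤ
±1 true  = 1ℤ
±1 false = -1ℤ

∣±1∣≡1 : ∀ b → ℤ.∣ ±1 b ∣ ≡ 1
∣±1∣≡1 true  = refl
∣±1∣≡1 false = refl

∣i-[i+j]∣≡∣j∣ : ∀ i j → ℤ.∣ i ℤ.- (i ℤ.+ j) ∣ ≡ ℤ.∣ j ∣
∣i-[i+j]∣≡∣j∣ i j = trans
  (cong ℤ.∣_∣ (solve 2 (λ i j → i :- (i :+ j) := :- j) refl i j))
  (ℤₚ.∣-i∣≡∣i∣ j)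
  where open ℤ-Solver

-- From a realization to an assignment

-- The positions are variables so that matching on `refl` replaces them by numerals; each wrong
-- branch then contains a false equation between closed numbers.
all-false-unrealizable : ∀ x₁ x₂ x₃ x₄ x₅ x₆ x₇ x₈ →
  ℤ.∣ + 0 ℤ.- x₂ ∣ ≡ 4 → ℤ.∣ + 0 ℤ.- x₇ ∣ ≡ 2 →
  ℤ.∣ -1ℤ ℤ.- x₂ ∣ ≡ 3 → ℤ.∣ -1ℤ ℤ.- x₇ ∣ ≡ 1 →
  ℤ.∣ x₂ ℤ.- x₄ ∣ ≡ 2 → ℤ.∣ x₇ ℤ.- x₃ ∣ ≡ 4 →
  ℤ.∣ + 2 ℤ.- x₁ ∣ ≡ 4 → ℤ.∣ x₁ ℤ.- x₅ ∣ ≡ 2 → ℤ.∣ x₅ ℤ.- x₆ ∣ ≡ 1 →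
  ℤ.∣ x₃ ℤ.- x₆ ∣ ≡ 1 → ℤ.∣ x₄ ℤ.- x₆ ∣ ≡ 1 →
  ℤ.∣ -1ℤ ℤ.- x₈ ∣ ≡ 4 → ℤ.∣ x₆ ℤ.- x₈ ∣ ≡ 2 → ⊥
all-false-unrealizable x₁ x₂ x₃ x₄ x₅ x₆ x₇ x₈
  A—2 A—7 L₁—2 L₂—7 2—4 7—3 B—1 1—5 5—6 3—6 4—6 L₃—8 6—8
  = near-B (c₆≡-7
      (c₃-position (c₇-position (neighbour (+ 0) x₇ A—7)))
      (c₄-position (c₂-position (neighbour (+ 0) x₂ A—2))))
  where
  c₂-position : x₂ ≡ -[1+ 3 ] ⊎ x₂ ≡ + 4 → x₂ ≡ -[1+ 3 ]
  c₂-position (inj₁ eq)   = eq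
  c₂-position (inj₂ refl) = contradiction L₁—2 λ ()

  c₇-position : x₇ ≡ -[1+ 1 ] ⊎ x₇ ≡ + 2 → x₇ ≡ -[1+ 1 ]
  c₇-position (inj₁ eq)   = eq
  c₇-position (inj₂ refl) = contradiction L₂—7 λ ()

  c₄-position : x₂ ≡ -[1+ 3 ] → x₄ ≡ -[1+ 5 ] ⊎ x₄ ≡ -[1+ 1 ]
  c₄-position refl = neighbour -[1+ 3 ] x₄ 2—4

  c₃-position : x₇ ≡ -[1+ 1 ] → x₃ ≡ -[1+ 5 ] ⊎ x₃ ≡ + 2
  c₃-position refl = neighbour -[1+ 1 ] x₃ 7—3

  c₆≡-7 : x₃ ≡ -[1+ 5 ] ⊎ x₃ ≡ + 2 → x₄ ≡ -[1+ 5 ] ⊎ x₄ ≡ -[1+ 1 ] → x₆ ≡ -[1+ 6 ]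
  c₆≡-7 (inj₁ refl) _ with neighbour -[1+ 5 ] x₆ 3—6
  ... | inj₁ eq = eq
  -- Here `c₆` would be at -5, but `c₈` is at -5 or 3, and neither is at distance 2.
  ... | inj₂ refl with neighbour -1ℤ x₈ L₃—8
  ...   | inj₁ refl = contradiction 6—8 λ ()
  ...   | inj₂ refl = contradiction 6—8 λ ()
  -- With `c₃` at 2, `c₆` would be at 1 or 3, too far from `c₄` at -6 or -2.
  c₆≡-7 (inj₂ refl) (inj₁ refl) with neighbour (+ 2) x₆ 3—6
  ... | inj₁ refl = contradiction 4—6 λ ()
  ... | inj₂ refl = contradiction 4—6 λ ()
  c₆≡-7 (inj₂ refl) (inj₂ refl) with neighbour (+ 2) x₆ 3—6
  ... | inj₁ refl = contradiction 4—6 λ ()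
  ... | inj₂ refl = contradiction 4—6 λ ()

  near-B : x₆ ≡ -[1+ 6 ] → ⊥
  -- `c₁` is at -2 or 6, so `c₅` is at -4, 0, 4 or 8, always at least 3 away from -7.
  near-B refl with neighbour (+ 2) x₁ B—1
  ... | inj₁ refl with neighbour -[1+ 1 ] x₅ 1—5
  ...   | inj₁ refl = contradiction 5—6 λ ()
  ...   | inj₂ refl = contradiction 5—6 λ ()
  near-B refl | inj₂ refl with neighbour (+ 6) x₅ 1—5
  ...   | inj₁ refl = contradiction 5—6 λ ()
  ...   | inj₂ refl = contradiction 5—6 λ ()

-- Both positions are 1 or -1, and the edge of length 2 rules out equal ones. In the two remaining
-- cases the test against 1 evaluates on numerals.
literal-pair : ∀ s s̄ → ℤ.∣ s ℤ.- s̄ ∣ ≡ 2 → ℤ.∣ + 0 ℤ.- s ∣ ≡ 1 → ℤ.∣ + 0 ℤ.- s̄ ∣ ≡ 1 →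
  s ≡ ±1 (does (s ℤₚ.≟ 1ℤ)) × s̄ ≡ ±1 (not (does (s ℤₚ.≟ 1ℤ)))
literal-pair s s̄ apart 0—s 0—s̄ with neighbour (+ 0) s 0—s | neighbour (+ 0) s̄ 0—s̄
... | inj₁ refl | inj₂ refl = refl , refl
... | inj₂ refl | inj₁ refl = refl , refl
literal-pair _ _ () _ _ | inj₁ refl | inj₁ refl
literal-pair _ _ () _ _ | inj₂ refl | inj₂ refl

module _ {n m : ℕ} (φ : 3SAT n m) where

  integer⇒satisfiable : HasIntegerRealization (𝒢 φ) → Satisfiable φ
  integer⇒satisfiable G-realized with normalize φ G-realized
  ... | x , x-realizes , A↦0 , B↦2 = a , lookup⁻ λ i → some-true (lookup φ i) (not-all-false i)
    where
    a : Assignment n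
    a j = does (x (lit (pos j)) ℤₚ.≟ 1ℤ)

    from-A : ∀ {v d} → Edge φ A v d → ℤ.∣ + 0 ℤ.- x v ∣ ≡ d
    from-A {v} {d} e = subst (λ z → ℤ.∣ z ℤ.- x v ∣ ≡ d) A↦0 (x-realizes e)

    literal-value : ∀ ℓ → x (lit ℓ) ≡ ±1 (eval a ℓ)
    literal-value (pos j) =
      proj₁ (literal-pair (x (lit (pos j))) (x (lit (neg j))) (x-realizes (s—s̄ j)) (from-A (A—s j)) (from-A (A—s̄ j)))
    literal-value (neg j) =
      proj₂ (literal-pair (x (lit (pos j))) (x (lit (neg j))) (x-realizes (s—s̄ j)) (from-A (A—s j)) (from-A (A—s̄ j)))

    from-false : ∀ ℓ {v d} → eval a ℓ ≡ false → Edge φ (lit ℓ) v d → ℤ.∣ -1ℤ ℤ.- x v ∣ ≡ d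
    from-false ℓ {v} {d} ℓ-false e = subst (λ z → ℤ.∣ z ℤ.- x v ∣ ≡ d)
      (trans (literal-value ℓ) (cong ±1 ℓ-false)) (x-realizes e)

    not-all-false : ∀ i →
      eval a (lookup (lookup φ i) zero) ≡ false →
      eval a (lookup (lookup φ i) (suc zero)) ≡ false →
      eval a (lookup (lookup φ i) (suc (suc zero))) ≡ false → ⊥
    not-all-false i ℓ₁ ℓ₂ ℓ₃ = all-false-unrealizable
      (x (c₁ i)) (x (c₂ i)) (x (c₃ i)) (x (c₄ i)) (x (c₅ i)) (x (c₆ i)) (x (c₇ i)) (x (c₈ i))
      (from-A (A—c₂ i)) (from-A (A—c₇ i))
      (from-false _ ℓ₁ (L₁—c₂ i)) (from-false _ ℓ₂ (L₂—c₇ i))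
      (x-realizes (c₂—c₄ i)) (x-realizes (c₇—c₃ i))
      (subst (λ z → ℤ.∣ z ℤ.- x (c₁ i) ∣ ≡ 4) B↦2 (x-realizes (B—c₁ i)))
      (x-realizes (c₁—c₅ i)) (x-realizes (c₅—c₆ i))
      (x-realizes (c₃—c₆ i)) (x-realizes (c₄—c₆ i))
      (from-false _ ℓ₃ (L₃—c₈ i)) (x-realizes (c₆—c₈ i))

    -- Truth values are decidable, so refuting the all-false case yields an explicit true literal.
    some-true : (C : Clause n) →
      (eval a (lookup C zero) ≡ false → eval a (lookup C (suc zero)) ≡ false →
       eval a (lookup C (suc (suc zero))) ≡ false → ⊥) →
      Any (λ ℓ → eval a ℓ ≡ true) C
    some-true (ℓ₁ ∷ ℓ₂ ∷ ℓ₃ ∷ []) ¬FFF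
      with eval a ℓ₁ in eq₁ | eval a ℓ₂ in eq₂ | eval a ℓ₃ in eq₃
    ... | true  | _     | _     = here eq₁
    ... | false | true  | _     = there (here eq₂)
    ... | false | false | true  = there (there (here eq₃))
    ... | false | false | false = ⊥-elim (¬FFF refl refl refl)

-- From an assignment to a realization

-- `c₅` takes the unique multiple of 4 next to the odd number `c₆`, and `c₁` the value among -2 and
-- 6 at distance 2 from `c₅`.
c₁-position c₅-position : Bool → Bool → Bool → ℤ

c₅-position true  true  true  = + 8
c₅-position true  true  false = + 4
c₅-position true  false true  = + 4
c₅-position true  false false = + 0
c₅-position false true  true  = + 0
-- This clause also gives the all-false triple the default -4, which is not adjacent to -7;
-- satisfaction excludes that triple.
c₅-position false _     _     = -[1+ 3 ]

c₁-position true true  _    = + 6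
c₁-position true false true = + 6
c₁-position _    _     _    = -[1+ 1 ]

module _ {n m : ℕ} (φ : 3SAT n m) where

  satisfiable⇒integer : Satisfiable φ → HasIntegerRealization (𝒢 φ)
  satisfiable⇒integer (a , a-satisfies) = x , x-realizes
    where
    b₁ b₂ b₃ : Fin m → Bool
    b₁ i = eval a (lookup (lookup φ i) zero)
    b₂ i = eval a (lookup (lookup φ i) (suc zero))
    b₃ i = eval a (lookup (lookup φ i) (suc (suc zero)))

    x : Vertex n m → ℤ
    x A       = + 0
    x B       = + 2
    x (lit ℓ) = ±1 (eval a ℓ)
    x (c₁ i)  = c₁-position (b₁ i) (b₂ i) (b₃ i)
    -- Positions are partial sums of 4τ₁ + 2τ₂ + τ₃: `c₃` and `c₄` coincide, reached by adding the
    -- two even terms in either order, and `c₈` omits 2τ₂.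
    x (c₂ i)  = + 4 ℤ.* ±1 (b₁ i)
    x (c₃ i)  = + 4 ℤ.* ±1 (b₁ i) ℤ.+ + 2 ℤ.* ±1 (b₂ i)
    x (c₄ i)  = + 4 ℤ.* ±1 (b₁ i) ℤ.+ + 2 ℤ.* ±1 (b₂ i)
    x (c₅ i)  = c₅-position (b₁ i) (b₂ i) (b₃ i)
    x (c₆ i)  = + 4 ℤ.* ±1 (b₁ i) ℤ.+ + 2 ℤ.* ±1 (b₂ i) ℤ.+ ±1 (b₃ i)
    x (c₇ i)  = + 2 ℤ.* ±1 (b₂ i)
    x (c₈ i)  = + 4 ℤ.* ±1 (b₁ i) ℤ.+ ±1 (b₃ i)

    -- The one length that depends on satisfaction. It is stated for an arbitrary clause so that the
    -- vector can be split into its three literals.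
    c₅—c₆-length : (C : Clause n) → Any (λ ℓ → eval a ℓ ≡ true) C →
      let β₁ = eval a (lookup C zero)
          β₂ = eval a (lookup C (suc zero))
          β₃ = eval a (lookup C (suc (suc zero)))
      in ℤ.∣ c₅-position β₁ β₂ β₃ ℤ.- (+ 4 ℤ.* ±1 β₁ ℤ.+ + 2 ℤ.* ±1 β₂ ℤ.+ ±1 β₃) ∣ ≡ 1
    c₅—c₆-length (ℓ₁ ∷ ℓ₂ ∷ ℓ₃ ∷ []) some
      with eval a ℓ₁ in eq₁ | eval a ℓ₂ in eq₂ | eval a ℓ₃ in eq₃
    ... | true  | true  | true  = refl
    ... | true  | true  | false = refl
    ... | true  | false | true  = refl
    ... | true  | false | false = refl
    ... | false | true  | true  = refl
    ... | false | true  | false = refl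
    ... | false | false | true  = refl
    ... | false | false | false with some
    ...   | here t                 with () ← trans (sym eq₁) t
    ...   | there (here t)         with () ← trans (sym eq₂) t
    ...   | there (there (here t)) with () ← trans (sym eq₃) t

    x-realizes : IsIntegerRealization (𝒢 φ) x
    x-realizes A—B = refl
    x-realizes (s—s̄ j) with a j
    ... | true  = refl
    ... | false = refl
    x-realizes (A—s j) with a j
    ... | true  = refl
    ... | false = refl
    x-realizes (A—s̄ j) with a j
    ... | true  = refl
    ... | false = refl
    x-realizes (A—c₂ i) with b₁ i
    ... | true  = refl
    ... | false = refl
    x-realizes (A—c₇ i) with b₂ i
    ... | true  = refl
    ... | false = refl
    x-realizes (L₁—c₂ i) with b₁ i
    ... | true  = refl
    ... | false = refl
    x-realizes (L₂—c₇ i) with b₂ i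
    ... | true  = refl
    ... | false = refl
    x-realizes (c₂—c₄ i) with b₁ i | b₂ i
    ... | true  | true  = refl
    ... | true  | false = refl
    ... | false | true  = refl
    ... | false | false = refl
    x-realizes (c₇—c₃ i) with b₁ i | b₂ i
    ... | true  | true  = refl
    ... | true  | false = refl
    ... | false | true  = refl
    ... | false | false = refl
    x-realizes (B—c₁ i) with b₁ i | b₂ i | b₃ i
    ... | true  | true  | _     = refl
    ... | true  | false | true  = refl
    ... | true  | false | false = refl
    ... | false | _     | _     = refl
    x-realizes (c₁—c₅ i) with b₁ i | b₂ i | b₃ i
    ... | true  | true  | true  = refl
    ... | true  | true  | false = refl
    ... | true  | false | true  = refl
    ... | true  | false | false = refl
    ... | false | true  | true  = refl
    ... | false | true  | false = refl
    ... | false | false | _     = refl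
    x-realizes (c₅—c₆ i) = c₅—c₆-length (lookup φ i) (lookup⁺ a-satisfies i)
    x-realizes (c₃—c₆ i) = trans (∣i-[i+j]∣≡∣j∣ (x (c₃ i)) _) (∣±1∣≡1 (b₃ i))
    x-realizes (c₄—c₆ i) = trans (∣i-[i+j]∣≡∣j∣ (x (c₄ i)) _) (∣±1∣≡1 (b₃ i))
    x-realizes (L₃—c₈ i) with b₁ i | b₃ i
    ... | true  | true  = refl
    ... | true  | false = refl
    ... | false | true  = refl
    ... | false | false = refl
    x-realizes (c₆—c₈ i) with b₁ i | b₂ i | b₃ i
    ... | true  | true  | true  = refl
    ... | true  | true  | false = refl
    ... | true  | false | true  = refl
    ... | true  | false | false = refl
    ... | false | true  | true  = refl
    ... | false | true  | false = refl
    ... | false | false | true  = refl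
    ... | false | false | false = refl

theorem1 : ∀ (n m : ℕ) (φ : 3SAT n m) → Satisfiable φ ⇔ HasRealization (𝒢 φ)
theorem1 n m φ = mk⇔
  (integer⇒real (𝒢 φ) ∘ satisfiable⇒integer φ)
  (integer⇒satisfiable φ ∘ real⇒integer (𝒢 φ) A (A-centre φ))
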